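{- For every integer $\ell\ge 3$ and every $\varepsilon>0$ there is no randomized parameterized algorithm for oracle $\ell$-matroid intersection with running time $\left\lfloor 2^{(\ell-2-\varepsilon)\cdot k\log(k)}\right\rfloor\cdot \mathrm{poly}(n)$, where $n$ is the size of the ground set and $k$ is the rank of the matroids.
   Context: $\log$ is the logarithm in base $2$, and $\mathrm{poly}(n)$ denotes a polynomial function of $n$. A matroid is a pair $(E,\mathcal{I})$ with $E$ finite and $\mathcal{I}\subseteq 2^E$ the independent sets, satisfying the usual axioms; a basis is an inclusion-wise maximal independent set, and the rank is the cardinality of a basis. Oracle $\ell$-matroid intersection ($\ell$-MI): an instance is $(E,\mathcal{I}_1,\ldots,\mathcal{I}_\ell)$ such that $(E,\mathcal{I}_i)$ is a matroid for every $i\in\{1,\ldots,\ell\}$. The objective is to decide whether the $\ell$ matroids have a common basis. The ground set $E$ is given explicitly in the input, while each $\mathcal{I}_i$ is accessible only via a membership oracle, which in a single query on a set $S\subseteq E$ determines whether $S\in\mathcal{I}_i$. A randomized algorithm for a decision problem is an algorithm that returns "yes" with probability at least $\frac12$ on every "yes"-instance and returns "no" with probability $1$ on every "no"-instance. A randomized parameterized algorithm for oracle $\ell$-MI is a randomized algorithm for oracle $\ell$-MI which runs in time $f(k)\cdot\mathrm{poly}(n)$ for some function $f$, where $n=|E|$ and $k$ is the rank of $(E,\mathcal{I}_1)$, the first matroid of the instance (which equals the rank of all the matroids whenever a common basis exists). -}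

module Defs where

open import Data.Bool using (Bool; true; false; not; if_then_else_)
import Data.Bool.Properties as Bool
open import Data.Fin using (Fin; toℕ)
open import Data.Fin.Subset using (Subset; ⊥; ⁅_⁆; _∪_; _⊆_; _∈_; _∉_; ∣_∣)
open import Data.Integer using (ℤ; +_; -[1+_])
open import Data.List using (List; []; _∷_; _++_; map; filter; length; foldr)
open import Data.Maybe using (Maybe; just; nothing)
import Data.Maybe.Properties as Maybe
open import Data.Nat using (ℕ; zero; suc; _+_; _*_; _∸_; _^_; _≤_; _<_; _≤?_; _≡ᵇ_)
import Data.Nat as ℕ
open import Data.Nat.Properties using (m^n≢0)
open import Data.Product using (∃; ∃-syntax; _×_)
open import Data.Rational using (ℚ; ½; 1ℚ; ↥_; ↧ₙ_)
import Data.Rational as ℚ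
open import Data.Sum using (_⊎_; inj₁; inj₂)
open import Data.Vec using (Vec; []; _∷_; tabulate)
open import Relation.Binary.PropositionalEquality using (_≡_; _≢_)
open import Relation.Nullary using (Dec; does; ¬_)

------------------------------------------------------------------------
-- Matroids and ℓ-matroid intersection

-- The independent sets form an arbitrary classical family of subsets, hence
-- a Bool-valued function.
record Matroid (n : ℕ) : Set where
  field
    indep : Subset n → Bool

  Independent : Subset n → Set
  Independent S = indep S ≡ true

  field
    ⊥-independent : Independent ⊥
    hereditary    : ∀ {A B} → A ⊆ B → Independent B → Independent A
    augmentation  : ∀ {A B} → Independent A → Independent B → ∣ A ∣ < ∣ B ∣ →
                    ∃[ x ] x ∈ B × x ∉ A × Independent (A ∪ ⁅ x ⁆)

  IsBasis : Subset n → Set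
  IsBasis B = Independent B × (∀ C → Independent C → B ⊆ C → C ≡ B)

  HasRank : ℕ → Set
  HasRank k = ∃[ B ] IsBasis B × ∣ B ∣ ≡ k

-- The ground set is {0, …, n-1}.
record Instance (ℓ : ℕ) : Set where
  field
    n       : ℕ
    matroid : Fin ℓ → Matroid n

  HasCommonBasis : Set
  HasCommonBasis = ∃[ B ] (∀ i → Matroid.IsBasis (matroid i) B)

  FirstHasRank : ℕ → Set
  FirstHasRank k = ∀ i → toℕ i ≡ 0 → Matroid.HasRank (matroid i) k

------------------------------------------------------------------------
-- Probabilistic random access machines with membership oracles

-- Memory cells are indexed by ℕ and hold natural numbers of any size, and
-- every instruction has unit cost.

Memory : Set
Memory = ℕ → ℕ

_[_↦_] : Memory → ℕ → ℕ → Memory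
(μ [ d ↦ v ]) a = if a ≡ᵇ d then v else μ a

data Op : Set where
  add sub mul div : Op

⟦_⟧ : Op → ℕ → ℕ → ℕ
⟦ add ⟧ a b       = a + b
⟦ sub ⟧ a b       = a ∸ b
⟦ mul ⟧ a b       = a * b
⟦ div ⟧ a zero    = 0
⟦ div ⟧ a (suc b) = a ℕ./ suc b

-- All operands are cell addresses, except the constant of `set`, the
-- target of `jumpIfZero`, the matroid index of `query` and the answer of
-- `halt`.
data Instr (ℓ : ℕ) : Set where
  set        : (d c : ℕ) → Instr ℓ
  load       : (d a : ℕ) → Instr ℓ              -- μ[d] := μ[μ[a]]
  store      : (a s : ℕ) → Instr ℓ              -- μ[μ[a]] := μ[s]
  arith      : Op → (d a b : ℕ) → Instr ℓ
  jumpIfZero : (a target : ℕ) → Instr ℓ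
  flip       : (d : ℕ) → Instr ℓ                -- μ[d] := a fair coin
  query      : Fin ℓ → (d a : ℕ) → Instr ℓ      -- μ[d] := [ S ∈ 𝓘ᵢ ], see `window`
  halt       : Bool → Instr ℓ

Program : ℕ → Set
Program ℓ = List (Instr ℓ)

Oracle : ℕ → ℕ → Set
Oracle ℓ n = Fin ℓ → Subset n → Bool

-- The queried set is given by its characteristic vector, stored in n
-- consecutive cells starting at a base address.
window : ∀ {n} → Memory → ℕ → Subset n
window μ base = tabulate (λ e → not (μ (base + toℕ e) ≡ᵇ 0))

toBit : Bool → ℕ
toBit b = if b then 1 else 0

-- Leaving the program text counts as answering "no".
fetch : ∀ {ℓ} → Program ℓ → ℕ → Instr ℓ
fetch []      _        = halt false
fetch (x ∷ _) zero     = x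
fetch (_ ∷ P) (suc pc) = fetch P pc

record Config : Set where
  constructor ⟨_,_⟩
  field
    pc  : ℕ
    mem : Memory

-- Every step is supplied with a coin, which only `flip` looks at.
exec : ∀ {ℓ n} → Oracle ℓ n → Instr ℓ → Bool → Config → Config ⊎ Bool
exec O (set d c)        _ ⟨ pc , μ ⟩ = inj₁ ⟨ suc pc , μ [ d ↦ c ] ⟩
exec O (load d a)       _ ⟨ pc , μ ⟩ = inj₁ ⟨ suc pc , μ [ d ↦ μ (μ a) ] ⟩
exec O (store a s)      _ ⟨ pc , μ ⟩ = inj₁ ⟨ suc pc , μ [ μ a ↦ μ s ] ⟩
exec O (arith o d a b)  _ ⟨ pc , μ ⟩ = inj₁ ⟨ suc pc , μ [ d ↦ ⟦ o ⟧ (μ a) (μ b) ] ⟩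
exec O (jumpIfZero a t) _ ⟨ pc , μ ⟩ = inj₁ ⟨ (if μ a ≡ᵇ 0 then t else suc pc) , μ ⟩
exec O (flip d)         c ⟨ pc , μ ⟩ = inj₁ ⟨ suc pc , μ [ d ↦ toBit c ] ⟩
exec O (query i d a)    _ ⟨ pc , μ ⟩ = inj₁ ⟨ suc pc , μ [ d ↦ toBit (O i (window μ (μ a))) ] ⟩
exec O (halt b)         _ _          = inj₂ b

-- At most t steps with the coins ω; `nothing` means not halted yet.
run : ∀ {ℓ n t} → Program ℓ → Oracle ℓ n → Vec Bool t → Config → Maybe Bool
run P O []      C = nothing
run P O (c ∷ ω) C with exec O (fetch P (Config.pc C)) c C
... | inj₁ C′ = run P O ω C′
... | inj₂ b  = just b

-- The size of the ground set is in cell 0, all other cells are 0. The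
-- matroids are reachable only through the oracle.
output : ∀ {ℓ t} → Program ℓ → Instance ℓ → Vec Bool t → Maybe Bool
output P I ω = run P (λ i → Matroid.indep (matroid i)) ω ⟨ 0 , (λ _ → 0) [ 0 ↦ n ] ⟩
  where open Instance I

HaltsWithin : ∀ {ℓ} → Program ℓ → Instance ℓ → ℕ → Set
HaltsWithin P I t = (ω : Vec Bool t) → output P I ω ≢ nothing

allCoins : ∀ t → List (Vec Bool t)
allCoins zero    = [] ∷ []
allCoins (suc t) = map (false ∷_) (allCoins t) ++ map (true ∷_) (allCoins t)

-- The probability that P halts on I within t steps with answer b.
Pr : ∀ {ℓ} → Program ℓ → Instance ℓ → (t : ℕ) → Bool → ℚ
Pr P I t b = ℚ._/_ (+ length (filter answers? (allCoins t))) (2 ^ t) {{m^n≢0 2 t}}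
  where
  answers? : (ω : Vec Bool t) → Dec (output P I ω ≡ just b)
  answers? ω = Maybe.≡-dec Bool._≟_ (output P I ω) (just b)

-- Pr P I t b does not depend on t once t bounds the running time.
record IsRandomizedAlgorithm {ℓ : ℕ} (P : Program ℓ) : Set where
  field
    terminates : ∀ I → ∃[ t ] HaltsWithin P I t
    yes : ∀ I t → HaltsWithin P I t → Instance.HasCommonBasis I → ½ ℚ.≤ Pr P I t true
    no  : ∀ I t → HaltsWithin P I t → ¬ Instance.HasCommonBasis I → Pr P I t false ≡ 1ℚ

------------------------------------------------------------------------
-- Running times

-- Natural coefficients, constant term first; every polynomial is dominated
-- on ℕ by one of these.
Polynomial : Set
Polynomial = List ℕ

eval : Polynomial → ℕ → ℕ
eval p x = foldr (λ c r → c + x * r) 0 p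

-- Worst case over the coins.
RunsInTime_·poly : ∀ {ℓ} → (ℕ → ℕ) → Program ℓ → Set
RunsInTime_·poly f P = ∃[ p ] (∀ I k → Instance.FirstHasRank I k →
                               HaltsWithin P I (f k * eval p (Instance.n I)))

record RandomizedParameterizedAlgorithm (ℓ : ℕ) (f : ℕ → ℕ) : Set where
  field
    program      : Program ℓ
    isRandomized : IsRandomizedAlgorithm program
    runsInTime   : RunsInTime f ·poly program

pos neg : ℤ → ℕ
pos (+ a)    = a
pos -[1+ _ ] = 0
neg (+ _)    = 0
neg -[1+ a ] = suc a

-- For x = a / q we have 2 ^ (x · k · log k) = k ^ (x · k), so a natural
-- number v is at most this real number iff v ^ q ≤ k ^ (a · k). The negative
-- part of a is moved to the left to stay within ℕ. For k = 0 this agrees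
-- with the convention 0 · log 0 = 0, since 0 ^ 0 = 1.
_≤2^[_·_log] : ℕ → ℚ → ℕ → Set
v ≤2^[ x · k log] = v ^ (↧ₙ x) * k ^ (neg (↥ x) * k) ≤ k ^ (pos (↥ x) * k)

-- The largest v ≤ b with P v (or 0 if there is none).
greatest : {P : ℕ → Set} → (∀ v → Dec (P v)) → ℕ → ℕ
greatest P? zero    = zero
greatest P? (suc b) = if does (P? (suc b)) then suc b else greatest P? b

-- ⌊ 2 ^ (x · k · log k) ⌋. The search bound suffices because v ≤ v ^ q and
-- the factor k ^ (neg (↥ x) * k) is at least 1.
⌊2^[_·_log]⌋ : ℚ → ℕ → ℕ
⌊2^[ x · k log]⌋ = greatest {_≤2^[ x · k log]} (λ v → _ ≤? _) (k ^ (pos (↥ x) * k))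

{-# OPTIONS --safe #-}
-- Take the grid [k]^(ℓ-1) as ground set, with the ℓ - 1 partition matroids of its
-- coordinates. Their common bases are the (k!)^(ℓ-2) perfect matchings. Two different
-- matchings never differ by the exchange of a single element, so declaring any family
-- of them dependent in the uniform matroid of rank k leaves a sparse paving matroid.
-- Forbidding all matchings gives a no-instance, forbidding all but one gives a
-- yes-instance, and the two are told apart only by querying the hidden matching.
-- A run of length t on the no-instance queries at most t matchings, so averaging over
-- the coins and the matchings gives (k!)^(ℓ-2) ≤ 2t. As k^k ≤ 4^k k!, this fails for
-- large k when t is polynomial in k times k^((ℓ-2-ε)k).
module Submission where

open import Defs
open import Data.Bool using (Bool; true; false)
import Data.Bool.Properties as Bool
open import Data.Empty using (⊥-elim)
open import Data.Fin using (Fin; zero; suc; combine; quotient; remainder; punchIn; finToFun; funToFin; fromℕ<)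
import Data.Fin.Properties as Fin
open import Data.Fin.Subset using (Subset; inside; outside; ⊥; ⊤; ⁅_⁆; _∪_; _⊆_; _∈_; _∉_; ∣_∣; _-_)
open import Data.Fin.Subset.Properties
open import Data.Integer using (+_; -[1+_])
import Data.Integer as ℤ
import Data.Integer.Properties as ℤ
open import Data.List using (List; []; _∷_; _++_; map; filter; length; lookup)
import Data.List.Membership.Propositional as List
open import Data.List.Membership.Propositional.Properties using (∈-++⁺ˡ; ∈-++⁺ʳ)
open import Data.List.Properties using (length-++; length-map; filter-complete)
open import Data.List.Relation.Unary.All using (All; []; _∷_)
import Data.List.Relation.Unary.All as All
open import Data.List.Relation.Unary.All.Properties using (all-filter)
open import Data.List.Relation.Unary.Any using (here; index; any?)
open import Data.List.Relation.Unary.Any.Properties using (lookup-index)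
open import Data.Maybe using (just)
import Data.Maybe.Properties as Maybe
open import Data.Nat
open import Data.Nat.ListAction using () renaming (sum to sumᴸ)
open import Data.Nat.Properties
open import Data.Nat.Tactic.RingSolver using (solve-∀)
open import Data.Product using (∃-syntax; _×_; _,_; proj₁; proj₂)
open import Data.Rational using (ℚ; 0ℚ; ½; 1ℚ; ↧ₙ_)
import Data.Rational as ℚ
import Data.Rational.Properties as ℚ
open import Data.Rational.Unnormalised using (mkℚᵘ; *≡*; *≤*; *<*)
import Data.Rational.Unnormalised.Properties as ℚᵘ
open import Data.Sum using (_⊎_; inj₁; inj₂; [_,_]′)
open import Data.Vec using (Vec; []; _∷_; tabulate; here; there)
import Data.Vec.Properties as Vec
open import Function using (_∘_; id; const; mk⇔)
open import Relation.Binary.PropositionalEquality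
open import Relation.Nullary
open import Relation.Nullary.Decidable using (dec-true; decidable-stable; does-⇔)
open import Relation.Unary using (Decidable)

open import Algebra.Properties.CommutativeMonoid.Sum +-0-commutativeMonoid using (sum; sum-cong-≗; sum-replicate-zero; ∑-distrib-+)

private
  variable
    ℓ k n m t : ℕ

-- Growth of factorials

^-distribʳ-* : ∀ m n o → (m * n) ^ o ≡ m ^ o * n ^ o
^-distribʳ-* m n zero    = refl
^-distribʳ-* m n (suc o) = begin
  m * n * (m * n) ^ o         ≡⟨ cong (m * n *_) (^-distribʳ-* m n o) ⟩
  m * n * (m ^ o * n ^ o)     ≡⟨ [m*n]*[o*p]≡[m*o]*[n*p] m n (m ^ o) (n ^ o) ⟩
  m * m ^ o * (n * n ^ o)     ∎
  where open ≡-Reasoning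

m≤m^n : ∀ m n .{{_ : NonZero n}} → m ≤ m ^ n
m≤m^n zero    n       = z≤n
m≤m^n (suc m) (suc n) = m≤m*n (suc m) (suc m ^ n) {{m^n≢0 (suc m) n}}

-- Each of the `b` factors of `(a + b) !` beyond `a !` is at least `a`.
a^b*a!≤[a+b]! : ∀ a b → a ^ b * a ! ≤ (a + b) !
a^b*a!≤[a+b]! a zero    = ≤-reflexive (trans (*-identityˡ (a !)) (cong _! (sym (+-identityʳ a))))
a^b*a!≤[a+b]! a (suc b) = begin
  a * a ^ b * a !             ≡⟨ *-assoc a (a ^ b) (a !) ⟩
  a * (a ^ b * a !)           ≤⟨ *-mono-≤ (m≤n⇒m≤1+n (m≤m+n a b)) (a^b*a!≤[a+b]! a b) ⟩
  suc (a + b) * (a + b) !     ≡⟨ cong _! (+-suc a b) ⟨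
  (a + suc b) !               ∎
  where open ≤-Reasoning

-- Pascal's rule bounds the binomial coefficient by 2 ^ (a + b).
[a+b]!≤2^[a+b]*a!*b! : ∀ a b → (a + b) ! ≤ 2 ^ (a + b) * (a ! * b !)
[a+b]!≤2^[a+b]*a!*b! zero b = begin
  b !                  ≡⟨ +-identityʳ (b !) ⟨
  1 * b !              ≤⟨ m≤n*m (1 * b !) (2 ^ b) {{m^n≢0 2 b}} ⟩
  2 ^ b * (1 * b !)    ∎
  where open ≤-Reasoning
[a+b]!≤2^[a+b]*a!*b! (suc a) zero = begin
  (suc a + 0) !                            ≡⟨ cong _! (+-identityʳ (suc a)) ⟩
  suc a !                                  ≡⟨ *-identityʳ (suc a !) ⟨
  suc a ! * 1                              ≤⟨ m≤n*m (suc a ! * 1) (2 ^ (suc a + 0)) {{m^n≢0 2 (suc a + 0)}} ⟩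
  2 ^ (suc a + 0) * (suc a ! * 1)          ∎
  where open ≤-Reasoning
[a+b]!≤2^[a+b]*a!*b! (suc a) (suc b) = begin
  suc (a + suc b) * (a + suc b) !
    ≡⟨ *-distribʳ-+ ((a + suc b) !) (suc a) (suc b) ⟩
  suc a * (a + suc b) ! + suc b * (a + suc b) !
    ≡⟨ cong (λ c → suc a * (a + suc b) ! + suc b * c !) (+-suc a b) ⟩
  suc a * (a + suc b) ! + suc b * (suc a + b) !
    ≤⟨ +-mono-≤ (*-monoʳ-≤ (suc a) ([a+b]!≤2^[a+b]*a!*b! a (suc b)))
                (*-monoʳ-≤ (suc b) ([a+b]!≤2^[a+b]*a!*b! (suc a) b)) ⟩
  suc a * (2 ^ (a + suc b) * (a ! * suc b !)) + suc b * (2 ^ (suc a + b) * (suc a ! * b !))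
    ≡⟨ cong (λ c → suc a * (2 ^ (a + suc b) * (a ! * suc b !)) + suc b * (2 ^ c * (suc a ! * b !))) (+-suc a b) ⟨
  suc a * (2 ^ (a + suc b) * (a ! * (suc b * b !))) + suc b * (2 ^ (a + suc b) * (suc a * a ! * b !))
    ≡⟨ regroup (suc a) (suc b) (2 ^ (a + suc b)) (a !) (b !) ⟩
  2 ^ suc (a + suc b) * (suc a ! * suc b !) ∎
  where
  open ≤-Reasoning
  regroup : ∀ a b t x y → a * (t * (x * (b * y))) + b * (t * (a * x * y)) ≡ 2 * t * (a * x * (b * y))
  regroup = solve-∀

-- A weak form of Stirling's bound. Both previous estimates at `a = b = k` enclose `(k + k) !`, and
-- one factor `k !` cancels.
k^k≤2^[k+k]*k! : ∀ k → k ^ k ≤ 2 ^ (k + k) * k !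
k^k≤2^[k+k]*k! k = *-cancelʳ-≤ (k ^ k) (2 ^ (k + k) * k !) (k !) {{k !≢0}} (begin
  k ^ k * k !                    ≤⟨ a^b*a!≤[a+b]! k k ⟩
  (k + k) !                      ≤⟨ [a+b]!≤2^[a+b]*a!*b! k k ⟩
  2 ^ (k + k) * (k ! * k !)      ≡⟨ *-assoc (2 ^ (k + k)) (k !) (k !) ⟨
  2 ^ (k + k) * k ! * k !        ∎)
  where open ≤-Reasoning

-- For `x ≥ 1` every monomial is at most `x ^ length p`, whose exponent is one above the formal
-- degree.
eval-≤ : ∀ p x .{{_ : NonZero x}} → eval p x ≤ sumᴸ p * x ^ length p
eval-≤ []      x = z≤n
eval-≤ (c ∷ p) x = begin
  c + x * eval p x                        ≤⟨ +-mono-≤ (m≤m*n c (x * x ^ length p) {{m^n≢0 x (suc (length p))}}) (*-monoʳ-≤ x (eval-≤ p x)) ⟩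
  c * (x * x ^ length p) + x * (sumᴸ p * x ^ length p) ≡⟨ regroup c x (sumᴸ p) (x ^ length p) ⟩
  (c + sumᴸ p) * (x * x ^ length p)        ∎
  where
  open ≤-Reasoning
  regroup : ∀ c x s y → c * (x * y) + x * (s * y) ≡ (c + s) * (x * y)
  regroup = solve-∀

-- The witness splits as `K = d + r` with `d ≤ r`. Then `K ^ d` matches the polynomial factor, while
-- `b ^ K ≤ (b * b) ^ r` and `c ≤ c ^ r` merge into `(b * b * c) ^ r`. The choice of `r` makes `K`
-- exceed that base.
k^k-dominates : ∀ b c d .{{_ : NonZero b}} → ∃[ k ] NonZero k × b ^ k * (c * k ^ d) < k ^ k
k^k-dominates b c d = K , K≢0 , (begin-strict
  b ^ K * (c * K ^ d)       ≤⟨ *-mono-≤ (^-monoʳ-≤ b (+-monoˡ-≤ r d≤r)) (*-monoˡ-≤ (K ^ d) (m≤m^n c r)) ⟩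
  b ^ (r + r) * (c ^ r * K ^ d) ≡⟨ cong (_* (c ^ r * K ^ d)) (^-distribˡ-+-* b r r) ⟩
  b ^ r * b ^ r * (c ^ r * K ^ d) ≡⟨ *-assoc (b ^ r * b ^ r) (c ^ r) (K ^ d) ⟨
  b ^ r * b ^ r * c ^ r * K ^ d ≡⟨ cong (λ z → z * c ^ r * K ^ d) (^-distribʳ-* b b r) ⟨
  (b * b) ^ r * c ^ r * K ^ d ≡⟨ cong (_* K ^ d) (^-distribʳ-* (b * b) c r) ⟨
  (b * b * c) ^ r * K ^ d   <⟨ *-monoˡ-< (K ^ d) {{m^n≢0 K d {{K≢0}}}} (^-monoˡ-< r bbc<K) ⟩
  K ^ r * K ^ d             ≡⟨ *-comm (K ^ r) (K ^ d) ⟩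
  K ^ d * K ^ r             ≡⟨ ^-distribˡ-+-* K d r ⟨
  K ^ K                     ∎)
  where
  open ≤-Reasoning
  r K : ℕ
  r = suc (d + b * b * c)
  K = d + r
  d≤r : d ≤ r
  d≤r = m≤n⇒m≤1+n (m≤m+n d (b * b * c))
  bbc<K : b * b * c < K
  bbc<K = ≤-trans (s≤s (m≤n+m (b * b * c) d)) (m≤n+m r d)
  K≢0 : NonZero K
  K≢0 = >-nonZero (≤-<-trans z≤n bbc<K)

-- If this failed, multiplying (k !) ^ (m * q) ≤ (2 * v * E) ^ q by k ^ k and cancelling
-- (k !) ^ (m * q) against k ^ (m * q * k) ≤ (4 ^ k * k !) ^ (m * q) would leave
-- k ^ k ≤ (4 ^ (m * q)) ^ k * (2 * E) ^ q, where E = eval p (k ^ suc m) is polynomial in k.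
factorial-beats-time : ∀ m q .{{_ : NonZero q}} p → ∃[ k ] NonZero k ×
  (∀ v → v ^ q * k ^ k ≤ k ^ (m * q * k) → 2 * (v * eval p (k ^ suc m)) < (k !) ^ m)
factorial-beats-time m q p with k^k-dominates (2 ^ (2 * (m * q))) ((2 * sumᴸ p) ^ q) (suc m * length p * q) {{m^n≢0 2 (2 * (m * q))}}
... | k , k≢0 , dom = k , k≢0 , λ v hyp → ≰⇒> λ le → <⇒≱ dom (k^k≤ v hyp le)
  where
  open ≤-Reasoning
  instance _ = k≢0
  N E W B : ℕ
  N = k ^ suc m
  E = eval p N
  W = 2 * E
  B = 2 ^ (2 * (m * q))
  W^q≤ : W ^ q ≤ (2 * sumᴸ p) ^ q * k ^ (suc m * length p * q)
  W^q≤ = begin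
    W ^ q                                          ≤⟨ ^-monoˡ-≤ q (*-monoʳ-≤ 2 (eval-≤ p N {{m^n≢0 k (suc m)}})) ⟩
    (2 * (sumᴸ p * N ^ length p)) ^ q               ≡⟨ cong (_^ q) (*-assoc 2 (sumᴸ p) (N ^ length p)) ⟨
    (2 * sumᴸ p * N ^ length p) ^ q                 ≡⟨ ^-distribʳ-* (2 * sumᴸ p) (N ^ length p) q ⟩
    (2 * sumᴸ p) ^ q * (N ^ length p) ^ q           ≡⟨ cong (λ z → (2 * sumᴸ p) ^ q * z ^ q) (^-*-assoc k (suc m) (length p)) ⟩
    (2 * sumᴸ p) ^ q * (k ^ (suc m * length p)) ^ q ≡⟨ cong ((2 * sumᴸ p) ^ q *_) (^-*-assoc k (suc m * length p) q) ⟩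
    (2 * sumᴸ p) ^ q * k ^ (suc m * length p * q)   ∎
  k^mqk≤ : k ^ (m * q * k) ≤ B ^ k * (k !) ^ (m * q)
  k^mqk≤ = begin
    k ^ (m * q * k)                          ≡⟨ cong (k ^_) (*-comm (m * q) k) ⟩
    k ^ (k * (m * q))                        ≡⟨ ^-*-assoc k k (m * q) ⟨
    (k ^ k) ^ (m * q)                        ≤⟨ ^-monoˡ-≤ (m * q) (k^k≤2^[k+k]*k! k) ⟩
    (2 ^ (k + k) * k !) ^ (m * q)            ≡⟨ ^-distribʳ-* (2 ^ (k + k)) (k !) (m * q) ⟩
    (2 ^ (k + k)) ^ (m * q) * (k !) ^ (m * q) ≡⟨ cong (_* (k !) ^ (m * q)) (^-*-assoc 2 (k + k) (m * q)) ⟩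
    2 ^ ((k + k) * (m * q)) * (k !) ^ (m * q) ≡⟨ cong (λ e → 2 ^ e * (k !) ^ (m * q)) (exponent k (m * q)) ⟩
    2 ^ (2 * (m * q) * k) * (k !) ^ (m * q)  ≡⟨ cong (_* (k !) ^ (m * q)) (^-*-assoc 2 (2 * (m * q)) k) ⟨
    B ^ k * (k !) ^ (m * q)                  ∎
    where
    exponent : ∀ k x → (k + k) * x ≡ 2 * x * k
    exponent = solve-∀
  k^k≤ : ∀ v → v ^ q * k ^ k ≤ k ^ (m * q * k) → (k !) ^ m ≤ 2 * (v * E) →
         k ^ k ≤ B ^ k * ((2 * sumᴸ p) ^ q * k ^ (suc m * length p * q))
  k^k≤ v hyp le = ≤-trans
    (*-cancelʳ-≤ (k ^ k) (B ^ k * W ^ q) ((k !) ^ (m * q)) {{m^n≢0 (k !) (m * q) {{k !≢0}}}} (begin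
      k ^ k * (k !) ^ (m * q)             ≡⟨ cong (k ^ k *_) (^-*-assoc (k !) m q) ⟨
      k ^ k * ((k !) ^ m) ^ q             ≤⟨ *-monoʳ-≤ (k ^ k) (^-monoˡ-≤ q le) ⟩
      k ^ k * (2 * (v * E)) ^ q           ≡⟨ cong (λ z → k ^ k * z ^ q) (swap-factors v E) ⟩
      k ^ k * (v * W) ^ q                 ≡⟨ cong (k ^ k *_) (^-distribʳ-* v W q) ⟩
      k ^ k * (v ^ q * W ^ q)             ≡⟨ *-assoc (k ^ k) (v ^ q) (W ^ q) ⟨
      k ^ k * v ^ q * W ^ q               ≡⟨ cong (_* W ^ q) (*-comm (k ^ k) (v ^ q)) ⟩
      v ^ q * k ^ k * W ^ q               ≤⟨ *-monoˡ-≤ (W ^ q) (≤-trans hyp k^mqk≤) ⟩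
      B ^ k * (k !) ^ (m * q) * W ^ q     ≡⟨ swap-last (B ^ k) ((k !) ^ (m * q)) (W ^ q) ⟩
      B ^ k * W ^ q * (k !) ^ (m * q)     ∎))
    (*-monoʳ-≤ (B ^ k) W^q≤)
    where
    swap-factors : ∀ v e → 2 * (v * e) ≡ v * (2 * e)
    swap-factors = solve-∀
    swap-last : ∀ a b c → a * b * c ≡ a * c * b
    swap-last = solve-∀

-- Matroids on subsets of Fin n

does-true⇒ : {A : Set} (a? : Dec A) → does a? ≡ true → A
does-true⇒ (yes a) _ = a

comprehension : {P : Fin n → Set} → Decidable P → Subset n
comprehension P? = tabulate (does ∘ P?)

∈-comprehension⁺ : {P : Fin n → Set} (P? : Decidable P) {x : Fin n} → P x → x ∈ comprehension P?
∈-comprehension⁺ P? {x} px = Vec.lookup⇒[]= x _ (trans (Vec.lookup∘tabulate (does ∘ P?) x) (dec-true (P? x) px))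

∈-comprehension⁻ : {P : Fin n → Set} (P? : Decidable P) {x : Fin n} → x ∈ comprehension P? → P x
∈-comprehension⁻ P? {x} x∈ = does-true⇒ (P? x) (trans (sym (Vec.lookup∘tabulate (does ∘ P?) x)) (Vec.[]=⇒lookup x∈))

-- Pigeonhole for a relation, so that partners may be chosen from membership proofs instead of by a
-- function on all of `Fin n`. The first element of `A` is removed together with its partner `y`; by
-- injectivity no other element of `A` is related to `y`, so the rest finds its partners in `B - y`.
injective-relation⇒∣∣≤∣∣ : (A : Subset n) (B : Subset m) (R : Fin n → Fin m → Set) →
  (∀ x → x ∈ A → ∃[ y ] y ∈ B × R x y) →
  (∀ {x x′ y} → x ∈ A → x′ ∈ A → R x y → R x′ y → x ≡ x′) →
  ∣ A ∣ ≤ ∣ B ∣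
injective-relation⇒∣∣≤∣∣ []            B R total inj = z≤n
injective-relation⇒∣∣≤∣∣ (outside ∷ A) B R total inj =
  injective-relation⇒∣∣≤∣∣ A B (R ∘ suc) (λ x x∈A → total (suc x) (there x∈A))
    (λ x∈A x′∈A r r′ → Fin.suc-injective (inj (there x∈A) (there x′∈A) r r′))
injective-relation⇒∣∣≤∣∣ (inside ∷ A)  B R total inj with total zero here
... | y , y∈B , Rzy = ≤-<-trans
  (injective-relation⇒∣∣≤∣∣ A (B - y) (R ∘ suc)
    (λ x x∈A → let (y′ , y′∈B , r) = total (suc x) (there x∈A) in
      y′ , x∈p∧x≢y⇒x∈p-y y′∈B (λ { refl → Fin.0≢1+n (inj here (there x∈A) Rzy r) }) , r)
    (λ x∈A x′∈A r r′ → Fin.suc-injective (inj (there x∈A) (there x′∈A) r r′)))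
  (x∈p⇒∣p-x∣<∣p∣ y∈B)

⊈⇒∃∈∉ : {A B : Subset n} → ¬ (B ⊆ A) → ∃[ x ] x ∈ B × x ∉ A
⊈⇒∃∈∉ {A = A} {B} B⊈A with Fin.any? (λ x → x ∈? B ×-dec ¬? (x ∈? A))
... | yes found = found
... | no  none  = ⊥-elim (B⊈A (λ {x} x∈B → decidable-stable (x ∈? A) (λ x∉A → none (x , x∈B , x∉A))))

∣∣<∣∣⇒∃∈∉ : (A B : Subset n) → ∣ A ∣ < ∣ B ∣ → ∃[ x ] x ∈ B × x ∉ A
∣∣<∣∣⇒∃∈∉ A B lt = ⊈⇒∃∈∉ (λ B⊆A → <⇒≱ lt (p⊆q⇒∣p∣≤∣q∣ B⊆A))

⊆∧∣∣≥∣∣⇒≡ : {A B : Subset n} → A ⊆ B → ∣ B ∣ ≤ ∣ A ∣ → A ≡ B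
⊆∧∣∣≥∣∣⇒≡ {A = A} {B} A⊆B le with B ⊆? A
... | yes B⊆A = ⊆-antisym A⊆B B⊆A
... | no  B⊈A = ⊥-elim (<⇒≱ (p⊂q⇒∣p∣<∣q∣ (A⊆B , ⊈⇒∃∈∉ B⊈A)) le)

∈∪⁅⁆⁻ : (A : Subset n) (x : Fin n) {z : Fin n} → z ∈ A ∪ ⁅ x ⁆ → z ∈ A ⊎ z ≡ x
∈∪⁅⁆⁻ A x z∈ = [ inj₁ , inj₂ ∘ x∈⁅y⁆⇒x≡y x ]′ (x∈p∪q⁻ A ⁅ x ⁆ z∈)

⊆∪⁅⁆ : (A : Subset n) (x : Fin n) → A ⊆ A ∪ ⁅ x ⁆
⊆∪⁅⁆ A x = p⊆p∪q ⁅ x ⁆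

∈∪⁅⁆ : (A : Subset n) (x : Fin n) → x ∈ A ∪ ⁅ x ⁆
∈∪⁅⁆ A x = q⊆p∪q A ⁅ x ⁆ (x∈⁅x⁆ x)

∣∪⁅⁆∣≤ : (A : Subset n) (x : Fin n) → ∣ A ∪ ⁅ x ⁆ ∣ ≤ suc ∣ A ∣
∣∪⁅⁆∣≤ (outside ∷ A) zero    = s≤s (≤-reflexive (cong ∣_∣ (∪-identityʳ A)))
∣∪⁅⁆∣≤ (inside  ∷ A) zero    = s≤s (m≤n⇒m≤1+n (≤-reflexive (cong ∣_∣ (∪-identityʳ A))))
∣∪⁅⁆∣≤ (outside ∷ A) (suc x) = ∣∪⁅⁆∣≤ A x
∣∪⁅⁆∣≤ (inside  ∷ A) (suc x) = s≤s (∣∪⁅⁆∣≤ A x)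

∣∪⁅⁆∣> : {A : Subset n} {x : Fin n} → x ∉ A → ∣ A ∣ < ∣ A ∪ ⁅ x ⁆ ∣
∣∪⁅⁆∣> {A = A} {x} x∉A = p⊂q⇒∣p∣<∣q∣ (⊆∪⁅⁆ A x , x , ∈∪⁅⁆ A x , x∉A)

∣∪⁅⁆∣≡ : {A : Subset n} {x : Fin n} → x ∉ A → ∣ A ∪ ⁅ x ⁆ ∣ ≡ suc ∣ A ∣
∣∪⁅⁆∣≡ {A = A} {x} x∉A = ≤-antisym (∣∪⁅⁆∣≤ A x) (∣∪⁅⁆∣> x∉A)

decidableMatroid : {P : Subset n → Set} (P? : Decidable P) → P ⊥ →
  (∀ {A B} → A ⊆ B → P B → P A) →
  (∀ {A B} → P A → P B → ∣ A ∣ < ∣ B ∣ → ∃[ x ] x ∈ B × x ∉ A × P (A ∪ ⁅ x ⁆)) →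
  Matroid n
decidableMatroid P? empty hered augment = record
  { indep         = does ∘ P?
  ; ⊥-independent = dec-true (P? _) empty
  ; hereditary    = λ A⊆B iB → dec-true (P? _) (hered A⊆B (does-true⇒ (P? _) iB))
  ; augmentation  = λ iA iB lt →
      let (x , x∈B , x∉A , p) = augment (does-true⇒ (P? _) iA) (does-true⇒ (P? _) iB) lt
      in x , x∈B , x∉A , dec-true (P? _) p
  }

-- Partition matroids and sparse paving matroids

InjectiveOn : (Fin n → Fin k) → Subset n → Set
InjectiveOn c S = ∀ x y → x ∈ S → y ∈ S → c x ≡ c y → x ≡ y

injectiveOn? : (c : Fin n → Fin k) → Decidable (InjectiveOn c)
injectiveOn? c S = Fin.all? λ x → Fin.all? λ y → (x ∈? S) →-dec (y ∈? S) →-dec (c x Fin.≟ c y) →-dec (x Fin.≟ y)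

injectiveOn-⊆ : (c : Fin n → Fin k) {A B : Subset n} → A ⊆ B → InjectiveOn c B → InjectiveOn c A
injectiveOn-⊆ c A⊆B inj x y x∈A y∈A = inj x y (A⊆B x∈A) (A⊆B y∈A)

injectiveOn-∪⁅⁆ : (c : Fin n → Fin k) {A : Subset n} {x : Fin n} → InjectiveOn c A →
  (∀ y → y ∈ A → c y ≢ c x) → InjectiveOn c (A ∪ ⁅ x ⁆)
injectiveOn-∪⁅⁆ c {A} {x} inj new y z y∈ z∈ eq with ∈∪⁅⁆⁻ A x y∈ | ∈∪⁅⁆⁻ A x z∈
... | inj₁ y∈A  | inj₁ z∈A  = inj y z y∈A z∈A eq
... | inj₁ y∈A  | inj₂ refl = ⊥-elim (new y y∈A eq)
... | inj₂ refl | inj₁ z∈A  = ⊥-elim (new z z∈A (sym eq))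
... | inj₂ refl | inj₂ refl = refl

injectiveOn⇒∣∣≤ : (c : Fin n → Fin k) {S : Subset n} → InjectiveOn c S → ∣ S ∣ ≤ k
injectiveOn⇒∣∣≤ {k = k} c {S} inj = subst (∣ S ∣ ≤_) (∣⊤∣≡n k)
  (injective-relation⇒∣∣≤∣∣ S ⊤ (λ x y → c x ≡ y) (λ x _ → c x , ∈⊤ , refl)
    (λ x∈S x′∈S r r′ → inj _ _ x∈S x′∈S (trans r (sym r′))))

partitionMatroid : (Fin n → Fin k) → Matroid n
partitionMatroid c = decidableMatroid (injectiveOn? c)
  (λ x y x∈⊥ → ⊥-elim (∉⊥ x∈⊥)) (injectiveOn-⊆ c) augment
  where
  augment : ∀ {A B} → InjectiveOn c A → InjectiveOn c B → ∣ A ∣ < ∣ B ∣ →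
            ∃[ x ] x ∈ B × x ∉ A × InjectiveOn c (A ∪ ⁅ x ⁆)
  augment {A} {B} iA iB lt
    with Fin.any? (λ x → x ∈? B ×-dec ¬? (Fin.any? λ y → y ∈? A ×-dec (c y Fin.≟ c x)))
  ... | yes (x , x∈B , new) = x , x∈B , (λ x∈A → new (x , x∈A , refl)) ,
                              injectiveOn-∪⁅⁆ c iA (λ y y∈A eq → new (y , y∈A , eq))
  -- Here every class met by `B` is met by `A`. Since `B` has at most one element in each class,
  -- pairing elements of equal class gives `∣ B ∣ ≤ ∣ A ∣`.
  ... | no none = ⊥-elim (<⇒≱ lt (injective-relation⇒∣∣≤∣∣ B A (λ x y → c y ≡ c x)
    (λ x x∈B → decidable-stable (Fin.any? λ y → y ∈? A ×-dec (c y Fin.≟ c x)) (λ new → none (x , x∈B , new)))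
    (λ x∈B x′∈B r r′ → iB _ _ x∈B x′∈B (trans (sym r) r′))))

-- H selects the circuit-hyperplanes among the k-subsets; its value on other sets is irrelevant.
Paving : ℕ → (Subset n → Set) → Subset n → Set
Paving k H S = ∣ S ∣ < k ⊎ ∣ S ∣ ≡ k × ¬ H S

paving? : ∀ k {H : Subset n → Set} → Decidable H → Decidable (Paving k H)
paving? k H? S = (∣ S ∣ <? k) ⊎-dec ((∣ S ∣ ≟ k) ×-dec ¬? (H? S))

paving⇒∣∣≤ : (H : Subset n → Set) {S : Subset n} → Paving k H S → ∣ S ∣ ≤ k
paving⇒∣∣≤ H (inj₁ lt)       = <⇒≤ lt
paving⇒∣∣≤ H (inj₂ (eq , _)) = ≤-reflexive eq

-- The hypothesis says that no two `k`-sets in `H` differ by exchanging one element. Augmentation is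
-- delicate only for `∣ A ∣ = k - 1` and `∣ B ∣ = k`. If `A ∪ ⁅ x ⁆` is in `H`, then `B` is not
-- inside it, as it would equal it and be forbidden. So `B` offers some `y` outside `A ∪ ⁅ x ⁆`, and
-- `A ∪ ⁅ y ⁆` cannot be in `H` as well.
pavingMatroid : (k : ℕ) .{{_ : NonZero k}} {H : Subset n → Set} → Decidable H →
  (∀ {A x y} → x ∉ A → y ∉ A → suc ∣ A ∣ ≡ k → H (A ∪ ⁅ x ⁆) → H (A ∪ ⁅ y ⁆) → x ≡ y) →
  Matroid n
pavingMatroid {n} k {H} H? separated = decidableMatroid (paving? k H?)
  (inj₁ (subst (_< k) (sym (∣⊥∣≡0 n)) (>-nonZero⁻¹ k))) hered augment
  where
  hered : ∀ {A B} → A ⊆ B → Paving k H B → Paving k H A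
  hered {A} {B} A⊆B iB with ∣ A ∣ <? k
  ... | yes lt = inj₁ lt
  -- Now `k ≤ ∣ A ∣` and `∣ B ∣ ≤ k`, so the inclusion is an equality and nothing is lost.
  ... | no  ≮k = subst (Paving k H) (sym (⊆∧∣∣≥∣∣⇒≡ A⊆B (≤-trans (paving⇒∣∣≤ H iB) (≮⇒≥ ≮k)))) iB

  augment : ∀ {A B} → Paving k H A → Paving k H B → ∣ A ∣ < ∣ B ∣ →
            ∃[ x ] x ∈ B × x ∉ A × Paving k H (A ∪ ⁅ x ⁆)
  augment {A} {B} _ iB lt with ∣∣<∣∣⇒∃∈∉ A B lt | suc ∣ A ∣ <? k
  ... | x , x∈B , x∉A | yes 1+∣A∣<k = x , x∈B , x∉A , inj₁ (≤-<-trans (∣∪⁅⁆∣≤ A x) 1+∣A∣<k)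
  ... | x , x∈B , x∉A | no  1+∣A∣≮k = go iB
    where
    1+∣A∣≡k : suc ∣ A ∣ ≡ k
    1+∣A∣≡k = ≤-antisym (≤-trans lt (paving⇒∣∣≤ H iB)) (≮⇒≥ 1+∣A∣≮k)
    ∣A∪⁅_⁆∣≡k : ∀ z → z ∉ A → ∣ A ∪ ⁅ z ⁆ ∣ ≡ k
    ∣A∪⁅ z ⁆∣≡k z∉A = trans (∣∪⁅⁆∣≡ z∉A) 1+∣A∣≡k
    go : Paving k H B → ∃[ z ] z ∈ B × z ∉ A × Paving k H (A ∪ ⁅ z ⁆)
    go (inj₁ ∣B∣<k) = ⊥-elim (1+∣A∣≮k (≤-<-trans lt ∣B∣<k))
    go (inj₂ (∣B∣≡k , ¬hB)) with H? (A ∪ ⁅ x ⁆)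
    ... | no  ¬hx = x , x∈B , x∉A , inj₂ (∣A∪⁅ x ⁆∣≡k x∉A , ¬hx)
    ... | yes hx = y , y∈B , y∉A , inj₂ (∣A∪⁅ y ⁆∣≡k y∉A , ¬hy)
      where
      B⊈A∪x : ¬ (B ⊆ A ∪ ⁅ x ⁆)
      B⊈A∪x B⊆ = ¬hB (subst H (sym (⊆∧∣∣≥∣∣⇒≡ B⊆ (≤-reflexive (trans (∣A∪⁅ x ⁆∣≡k x∉A) (sym ∣B∣≡k))))) hx)
      y : Fin n
      y = proj₁ (⊈⇒∃∈∉ B⊈A∪x)
      y∈B : y ∈ B
      y∈B = proj₁ (proj₂ (⊈⇒∃∈∉ B⊈A∪x))
      y∉A∪x : y ∉ A ∪ ⁅ x ⁆
      y∉A∪x = proj₂ (proj₂ (⊈⇒∃∈∉ B⊈A∪x))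
      y∉A : y ∉ A
      y∉A y∈A = y∉A∪x (⊆∪⁅⁆ A x y∈A)
      ¬hy : ¬ H (A ∪ ⁅ y ⁆)
      ¬hy hy = y∉A∪x (subst (_∈ A ∪ ⁅ x ⁆) (separated x∉A y∉A 1+∣A∣≡k hx hy) (∈∪⁅⁆ A x))

_≟ˢ_ : (S T : Subset n) → Dec (S ≡ T)
_≟ˢ_ = Vec.≡-dec Bool._≟_

-- The Lehmer code of a permutation.
permutation : ∀ k → Fin (k !) → Fin k → Fin k
permutation (suc k) x zero    = quotient (k !) x
permutation (suc k) x (suc i) = punchIn (quotient (k !) x) (permutation k (remainder {suc k} (k !) x) i)

permutation-injective : ∀ k x {i j} → permutation k x i ≡ permutation k x j → i ≡ j
permutation-injective (suc k) x {zero}  {zero}  _  = refl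
permutation-injective (suc k) x {zero}  {suc j} eq = ⊥-elim (Fin.punchInᵢ≢i _ _ (sym eq))
permutation-injective (suc k) x {suc i} {zero}  eq = ⊥-elim (Fin.punchInᵢ≢i _ _ eq)
permutation-injective (suc k) x {suc i} {suc j} eq =
  cong suc (permutation-injective k _ (Fin.punchIn-injective _ _ _ eq))

-- The value at `zero` is the leading digit of the code. Once these digits agree, both tails are
-- shifted by the same injective `punchIn`, so the remaining digits agree by induction.
permutation-distinct : ∀ k {x y} → permutation k x ≗ permutation k y → x ≡ y
permutation-distinct zero    {zero} {zero} _ = refl
permutation-distinct (suc k) {x} {y} eq = begin
  x                                          ≡⟨ Fin.combine-remQuot {suc k} (k !) x ⟨
  combine (quotient (k !) x) (remainder {suc k} (k !) x) ≡⟨ cong₂ combine (eq zero) (permutation-distinct k tail) ⟩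
  combine (quotient (k !) y) (remainder {suc k} (k !) y) ≡⟨ Fin.combine-remQuot {suc k} (k !) y ⟩
  y                                          ∎
  where
  open ≡-Reasoning
  tail : permutation k (remainder {suc k} (k !) x) ≗ permutation k (remainder {suc k} (k !) y)
  tail i = Fin.punchIn-injective (quotient (k !) x) _ _
    (trans (eq (suc i)) (cong (λ q → punchIn q (permutation k (remainder {suc k} (k !) y) i)) (sym (eq zero))))

funToFin-cong : ∀ {m n} {f g : Fin m → Fin n} → f ≗ g → funToFin f ≡ funToFin g
funToFin-cong {zero}  eq = refl
funToFin-cong {suc m} eq = cong₂ combine (eq zero) (funToFin-cong (eq ∘ suc))

finToFun-injective : ∀ {m n} {x y : Fin (n ^ m)} → finToFun {n} {m} x ≗ finToFun y → x ≡ y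
finToFun-injective {m} {n} {x} {y} eq =
  trans (sym (Fin.funToFin-finToFin {m} {n} x)) (trans (funToFin-cong eq) (Fin.funToFin-finToFin {m} {n} y))

-- Hard instances for ℓ = m + 2 on the grid with m + 1 coordinates

module Grid (k m : ℕ) .{{k≢0 : NonZero k}} where

  size : ℕ
  size = k ^ suc m

  coord : Fin (suc m) → Fin size → Fin k
  coord i e = finToFun {k} {suc m} e i

  Transversal : Subset size → Set
  Transversal S = ∀ i → InjectiveOn (coord i) S

  transversal? : Decidable Transversal
  transversal? S = Fin.all? λ i → injectiveOn? (coord i) S

  -- If x and y differed in coordinate i, then A ∪ {x, y} would be a partial
  -- transversal with k + 1 elements.
  transversals-separated : ∀ {A x y} → x ∉ A → y ∉ A → suc ∣ A ∣ ≡ k →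
    Transversal (A ∪ ⁅ x ⁆) → Transversal (A ∪ ⁅ y ⁆) → x ≡ y
  transversals-separated {A} {x} {y} x∉A y∉A 1+∣A∣≡k tx ty = finToFun-injective {suc m} {k} same
    where
    same : ∀ i → coord i x ≡ coord i y
    same i with coord i x Fin.≟ coord i y
    ... | yes eq = eq
    ... | no  cx≢cy = ⊥-elim (<-irrefl refl (begin-strict
      k                            ≡⟨ 1+∣A∣≡k ⟨
      suc ∣ A ∣                    ≡⟨ ∣∪⁅⁆∣≡ x∉A ⟨
      ∣ A ∪ ⁅ x ⁆ ∣                <⟨ ∣∪⁅⁆∣> y∉A∪x ⟩
      ∣ (A ∪ ⁅ x ⁆) ∪ ⁅ y ⁆ ∣      ≤⟨ injectiveOn⇒∣∣≤ (coord i) (injectiveOn-∪⁅⁆ (coord i) (tx i) new) ⟩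
      k                            ∎))
      where
      open ≤-Reasoning
      y∉A∪x : y ∉ A ∪ ⁅ x ⁆
      y∉A∪x y∈ = [ y∉A , (λ { refl → cx≢cy refl }) ]′ (∈∪⁅⁆⁻ A x y∈)
      new : ∀ z → z ∈ A ∪ ⁅ x ⁆ → coord i z ≢ coord i y
      new z z∈ eq with ∈∪⁅⁆⁻ A x z∈
      ... | inj₁ z∈A  = y∉A (subst (_∈ A) (ty i z y (⊆∪⁅⁆ A y z∈A) (∈∪⁅⁆ A y) eq) z∈A)
      ... | inj₂ refl = cx≢cy eq

  module _ {H : Subset size → Set} (H? : Decidable H) (H⇒transversal : ∀ {S} → H S → Transversal S) where

    -- The paving matroid stands in second place, so the first matroid, whose rank is the parameter,
    -- does not depend on `H`.
    matroids : Fin (suc (suc m)) → Matroid size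
    matroids zero          = partitionMatroid (coord zero)
    matroids (suc zero)    = pavingMatroid k H? (λ x∉A y∉A eq hx hy →
      transversals-separated x∉A y∉A eq (H⇒transversal hx) (H⇒transversal hy))
    matroids (suc (suc i)) = partitionMatroid (coord (suc i))

    gridInstance : Instance (suc (suc m))
    gridInstance = record { n = size ; matroid = matroids }

  module _ (σ : Fin (suc m) → Fin k → Fin k) where

    point : Fin k → Fin size
    point r = funToFin {suc m} {k} (λ i → σ i r)

    coord-point : ∀ i r → coord i (point r) ≡ σ i r
    coord-point i r = Fin.finToFun-funToFin {suc m} {k} (λ i → σ i r) i

    line? : Decidable (λ e → ∃[ r ] e ≡ point r)
    line? e = Fin.any? λ r → e Fin.≟ point r

    -- When every `σ i` is a permutation, this is a perfect matching of the complete hypergraph with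
    -- `m + 1` parts of size `k`, with one hyperedge per parameter `r`.
    line : Subset size
    line = comprehension line?

    point∈line : ∀ r → point r ∈ line
    point∈line r = ∈-comprehension⁺ line? (r , refl)

    module _ (σ-injective : ∀ i {r s} → σ i r ≡ σ i s → r ≡ s) where

      line-transversal : Transversal line
      line-transversal i x y x∈ y∈ eq with ∈-comprehension⁻ line? x∈ | ∈-comprehension⁻ line? y∈
      ... | r , refl | s , refl =
        cong point (σ-injective i (trans (sym (coord-point i r)) (trans eq (coord-point i s))))

      ∣line∣≡k : ∣ line ∣ ≡ k
      ∣line∣≡k = ≤-antisym (injectiveOn⇒∣∣≤ (coord zero) (line-transversal zero))
        (subst (_≤ ∣ line ∣) (∣⊤∣≡n k)
          (injective-relation⇒∣∣≤∣∣ ⊤ line (λ r e → e ≡ point r) (λ r _ → point r , point∈line r , refl)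
            (λ {r} {s} _ _ e≡ e≡′ → σ-injective zero (trans (sym (coord-point zero r))
              (trans (cong (coord zero) (trans (sym e≡) e≡′)) (coord-point zero s))))))

  -- Coordinate 0 parametrizes the matching, so it carries no choice of permutation.
  permutations : Fin ((k !) ^ m) → Fin (suc m) → Fin k → Fin k
  permutations x zero    = id
  permutations x (suc i) = permutation k (finToFun {k !} {m} x i)

  permutations-injective : ∀ x i {r s} → permutations x i r ≡ permutations x i s → r ≡ s
  permutations-injective x zero    eq = eq
  permutations-injective x (suc i) eq = permutation-injective k _ eq

  matching : Fin ((k !) ^ m) → Subset size
  matching x = line (permutations x)

  matching-transversal : ∀ x → Transversal (matching x)
  matching-transversal x = line-transversal (permutations x) (permutations-injective x)

  ∣matching∣≡k : ∀ x → ∣ matching x ∣ ≡ k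
  ∣matching∣≡k x = ∣line∣≡k (permutations x) (permutations-injective x)

  -- The point with parameter `r` of one matching is the point with some parameter `s` of the other.
  -- Coordinate 0 is the identity in both and forces `r ≡ s`; the other coordinates then equate the
  -- permutations at `r`.
  matching-distinct : ∀ {x y} → matching x ≡ matching y → x ≡ y
  matching-distinct {x} {y} eq = finToFun-injective {m} {k !} (λ i → permutation-distinct k (same i))
    where
    same : ∀ i r → permutations x (suc i) r ≡ permutations y (suc i) r
    same i r with ∈-comprehension⁻ (line? (permutations y)) (subst (point (permutations x) r ∈_) eq (point∈line (permutations x) r))
    ... | s , e = trans (along (suc i)) (cong (permutations y (suc i)) (sym (along zero)))
      where
      along : ∀ j → permutations x j r ≡ permutations y j s
      along j = trans (sym (coord-point (permutations x) j r))
        (trans (cong (coord j) e) (coord-point (permutations y) j s))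

  someMatching : Fin ((k !) ^ m)
  someMatching = fromℕ< (m^n>0 (k !) {{k !≢0}} m)

  matching-isPartitionBasis : ∀ x i → Matroid.IsBasis (partitionMatroid (coord i)) (matching x)
  matching-isPartitionBasis x i = dec-true (injectiveOn? (coord i) _) (matching-transversal x i) ,
    λ C iC F⊆C → sym (⊆∧∣∣≥∣∣⇒≡ F⊆C (≤-trans
      (injectiveOn⇒∣∣≤ (coord i) (does-true⇒ (injectiveOn? (coord i) C) iC))
      (≤-reflexive (sym (∣matching∣≡k x)))))

  gridInstance-rank : ∀ {H : Subset size → Set} (H? : Decidable H) (H⇒ : ∀ {S} → H S → Transversal S) →
    Instance.FirstHasRank (gridInstance H? H⇒) k
  gridInstance-rank H? H⇒ zero _ =
    matching someMatching , matching-isPartitionBasis someMatching zero , ∣matching∣≡k someMatching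

  noInstance : Instance (suc (suc m))
  noInstance = gridInstance transversal? id

  -- Independence in the paving matroid leaves two cases. A set with fewer than `k` elements can be
  -- augmented from a matching in the first matroid, so it is not maximal there. A non-transversal
  -- set of size `k` fails to be independent in some partition matroid.
  noInstance-no : ¬ Instance.HasCommonBasis noInstance
  noInstance-no (B , basis) with does-true⇒ (paving? k transversal? B) (proj₁ (basis (suc zero)))
  ... | inj₁ ∣B∣<k = x∉B (subst (x ∈_) (proj₂ (basis zero) (B ∪ ⁅ x ⁆) iBx (⊆∪⁅⁆ B x)) (∈∪⁅⁆ B x))
    where
    F : Subset size
    F = matching someMatching
    M : Matroid size
    M = partitionMatroid (coord zero)
    augmented : ∃[ x ] x ∈ F × x ∉ B × Matroid.Independent M (B ∪ ⁅ x ⁆)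
    augmented = Matroid.augmentation M (proj₁ (basis zero)) (proj₁ (matching-isPartitionBasis someMatching zero))
      (subst (∣ B ∣ <_) (sym (∣matching∣≡k someMatching)) ∣B∣<k)
    x : Fin size
    x = proj₁ augmented
    x∉B : x ∉ B
    x∉B = proj₁ (proj₂ (proj₂ augmented))
    iBx : Matroid.Independent M (B ∪ ⁅ x ⁆)
    iBx = proj₂ (proj₂ (proj₂ augmented))
  ... | inj₂ (_ , ¬transversal) = ¬transversal λ where
    zero    → does-true⇒ (injectiveOn? (coord zero) B) (proj₁ (basis zero))
    (suc i) → does-true⇒ (injectiveOn? (coord (suc i)) B) (proj₁ (basis (suc (suc i))))

  module _ (x : Fin ((k !) ^ m)) where

    otherTransversal? : Decidable (λ S → Transversal S × S ≢ matching x)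
    otherTransversal? S = transversal? S ×-dec ¬? (S ≟ˢ matching x)

    yesInstance : Instance (suc (suc m))
    yesInstance = gridInstance otherTransversal? proj₁

    yesInstance-yes : Instance.HasCommonBasis yesInstance
    yesInstance-yes = matching x , λ where
      zero          → matching-isPartitionBasis x zero
      (suc zero)    → dec-true (paving? k otherTransversal? _) (inj₂ (∣matching∣≡k x , λ h → proj₂ h refl)) ,
        λ C iC F⊆C → sym (⊆∧∣∣≥∣∣⇒≡ F⊆C (≤-trans
          (paving⇒∣∣≤ (λ S → Transversal S × S ≢ matching x) (does-true⇒ (paving? k otherTransversal? C) iC))
          (≤-reflexive (sym (∣matching∣≡k x)))))
      (suc (suc i)) → matching-isPartitionBasis x (suc i)

    -- Only the paving matroid depends on the forbidden family, and the two families differ at the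
    -- hidden matching alone.
    instances-agree : ∀ i S → S ≢ matching x →
      Matroid.indep (Instance.matroid noInstance i) S ≡ Matroid.indep (Instance.matroid yesInstance i) S
    instances-agree zero          S S≢F = refl
    instances-agree (suc zero)    S S≢F = does-⇔ (mk⇔
      (λ { (inj₁ lt) → inj₁ lt ; (inj₂ (eq , ¬t)) → inj₂ (eq , λ h → ¬t (proj₁ h)) })
      (λ { (inj₁ lt) → inj₁ lt ; (inj₂ (eq , ¬h)) → inj₂ (eq , λ t → ¬h (t , S≢F)) }))
      (paving? k transversal? S) (paving? k otherTransversal? S)
    instances-agree (suc (suc i)) S S≢F = refl

-- Queries and coins

-- The matroid index is dropped: a set counts as queried whichever oracle receives it.
asked : Instr ℓ → Config → List (Subset n)
asked (query _ _ a) ⟨ _ , μ ⟩ = window μ (μ a) ∷ []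
asked _             _         = []

queries : Program ℓ → Oracle ℓ n → Vec Bool t → Config → List (Subset n)
queries P O []      C = []
queries P O (c ∷ ω) C = asked I C ++ [ queries P O ω , const [] ]′ (exec O I c C)
  where I = fetch P (Config.pc C)

length-asked : (I : Instr ℓ) (C : Config) → length (asked {n = n} I C) ≤ 1
length-asked (set d c)        C = z≤n
length-asked (load d a)       C = z≤n
length-asked (store a s)      C = z≤n
length-asked (arith o d a b)  C = z≤n
length-asked (jumpIfZero a t) C = z≤n
length-asked (flip d)         C = z≤n
length-asked (query i d a)    C = ≤-refl
length-asked (halt b)         C = z≤n

length-queries : (P : Program ℓ) (O : Oracle ℓ n) (ω : Vec Bool t) (C : Config) → length (queries P O ω C) ≤ t
length-queries P O []      C = z≤n
length-queries P O (c ∷ ω) C = begin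
  length (asked I C ++ rest)         ≡⟨ length-++ (asked I C) ⟩
  length (asked I C) + length rest   ≤⟨ +-mono-≤ (length-asked I C) (bound (exec O I c C)) ⟩
  suc _                              ∎
  where
  open ≤-Reasoning
  I = fetch P (Config.pc C)
  rest = [ queries P O ω , const [] ]′ (exec O I c C)
  bound : ∀ r → length ([ queries P O ω , const [] ]′ r) ≤ _
  bound (inj₁ C′) = length-queries P O ω C′
  bound (inj₂ b)  = z≤n

exec-cong : (O O′ : Oracle ℓ n) (I : Instr ℓ) (c : Bool) (C : Config) →
  (∀ i S → S List.∈ asked I C → O i S ≡ O′ i S) → exec O I c C ≡ exec O′ I c C
exec-cong O O′ (set d c)        _ C agree = refl
exec-cong O O′ (load d a)       _ C agree = refl
exec-cong O O′ (store a s)      _ C agree = refl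
exec-cong O O′ (arith o d a b)  _ C agree = refl
exec-cong O O′ (jumpIfZero a t) _ C agree = refl
exec-cong O O′ (flip d)         _ C agree = refl
exec-cong O O′ (query i d a)    _ ⟨ pc , μ ⟩ agree =
  cong (λ b → inj₁ ⟨ suc pc , μ [ d ↦ toBit b ] ⟩) (agree i _ (here refl))
exec-cong O O′ (halt b)         _ C agree = refl

-- With the coins fixed, a run learns about the matroids only through the answers to its own
-- queries. The queries are collected along the run with `O` only.
run-cong : (P : Program ℓ) (O O′ : Oracle ℓ n) (ω : Vec Bool t) (C : Config) →
  (∀ i S → S List.∈ queries P O ω C → O i S ≡ O′ i S) → run P O ω C ≡ run P O′ ω C
run-cong P O O′ []      C agree = refl
run-cong P O O′ (c ∷ ω) C agree
  with exec O (fetch P (Config.pc C)) c C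
     | exec O′ (fetch P (Config.pc C)) c C
     | exec-cong O O′ (fetch P (Config.pc C)) c C (λ i S S∈ → agree i S (∈-++⁺ˡ S∈))
     -- Abstracting the remaining agreement together with the result of `exec` lets its type reduce
     -- to the queries made from `C′`.
     | (λ i S S∈ → agree i S (∈-++⁺ʳ (asked (fetch P (Config.pc C)) C) S∈))
... | inj₁ C′ | _ | refl | agree′ = run-cong P O O′ ω C′ agree′
... | inj₂ b  | _ | refl | _      = refl

-- Double counting

∣comprehension∣ : {P : Fin n → Set} (P? : Decidable P) → ∣ comprehension P? ∣ ≡ sum (toBit ∘ does ∘ P?)
∣comprehension∣ {zero}  P? = refl
∣comprehension∣ {suc n} P? with does (P? zero)
... | true  = cong suc (∣comprehension∣ (P? ∘ suc))
... | false = ∣comprehension∣ (P? ∘ suc)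

length-filter-∷ : {A : Set} {P : A → Set} (P? : Decidable P) (x : A) (xs : List A) →
  length (filter P? (x ∷ xs)) ≡ toBit (does (P? x)) + length (filter P? xs)
length-filter-∷ P? x xs with does (P? x)
... | true  = refl
... | false = refl

-- The pairs related by `R` are counted by `y` instead of by `x`. In the application `x` is a hidden
-- matching and `y` a coin sequence.
double-counting : {A : Set} {R : Fin n → A → Set} (R? : ∀ x → Decidable (R x)) (b : ℕ) (ys : List A) →
  All (λ y → ∣ comprehension (λ x → R? x y) ∣ ≤ b) ys →
  sum (λ x → length (filter (R? x) ys)) ≤ length ys * b
double-counting {n} R? b []       []           = ≤-reflexive (sum-replicate-zero n)
double-counting {n} R? b (y ∷ ys) (y≤b ∷ ys≤b) = begin
  sum (λ x → length (filter (R? x) (y ∷ ys)))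
    ≡⟨ sum-cong-≗ (λ x → length-filter-∷ (R? x) y ys) ⟩
  sum (λ x → toBit (does (R? x y)) + length (filter (R? x) ys))
    ≡⟨ ∑-distrib-+ (λ x → toBit (does (R? x y))) (λ x → length (filter (R? x) ys)) ⟩
  sum (λ x → toBit (does (R? x y))) + sum (λ x → length (filter (R? x) ys))
    ≡⟨ cong (_+ sum (λ x → length (filter (R? x) ys))) (∣comprehension∣ (λ x → R? x y)) ⟨
  ∣ comprehension (λ x → R? x y) ∣ + sum (λ x → length (filter (R? x) ys))
    ≤⟨ +-mono-≤ y≤b (double-counting R? b ys ys≤b) ⟩
  b + length ys * b ∎
  where open ≤-Reasoning

n*a≤c*sum : ∀ {a} c (f : Fin n → ℕ) → (∀ x → a ≤ c * f x) → n * a ≤ c * sum f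
n*a≤c*sum {zero}      c f bound = z≤n
n*a≤c*sum {suc n} {a} c f bound = begin
  a + n * a                       ≤⟨ +-mono-≤ (bound zero) (n*a≤c*sum c (f ∘ suc) (bound ∘ suc)) ⟩
  c * f zero + c * sum (f ∘ suc)  ≡⟨ *-distribˡ-+ c (f zero) (sum (f ∘ suc)) ⟨
  c * sum f                       ∎
  where open ≤-Reasoning

-- Probabilities as counts of coin sequences

length-allCoins : ∀ t → length (allCoins t) ≡ 2 ^ t
length-allCoins zero    = refl
length-allCoins (suc t) = begin
  length (map (false ∷_) (allCoins t) ++ map (true ∷_) (allCoins t))
    ≡⟨ length-++ (map (false ∷_) (allCoins t)) ⟩
  length (map (false ∷_) (allCoins t)) + length (map (true ∷_) (allCoins t))
    ≡⟨ cong₂ _+_ (length-map (false ∷_) (allCoins t)) (length-map (true ∷_) (allCoins t)) ⟩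
  length (allCoins t) + length (allCoins t)
    ≡⟨ cong₂ _+_ (length-allCoins t) (trans (length-allCoins t) (sym (+-identityʳ (2 ^ t)))) ⟩
  2 ^ suc t ∎
  where open ≡-Reasoning

-- The quotient is stored in lowest terms. Its unnormalised form recovers `a` and `d` themselves,
-- and the order there is cross-multiplication.
½≤a/d⇒d≤2a : ∀ a d .{{_ : NonZero d}} → ½ ℚ.≤ (+ a) ℚ./ d → d ≤ 2 * a
½≤a/d⇒d≤2a a (suc d) le
  with ℚᵘ.≤-trans (ℚ.toℚᵘ-mono-≤ le) (ℚᵘ.≤-reflexive (ℚ.toℚᵘ-fromℚᵘ (mkℚᵘ (+ a) d)))
... | *≤* le′ = subst₂ _≤_ (*-identityˡ (suc d)) (*-comm a 2)
  (ℤ.drop‿+≤+ (subst₂ ℤ._≤_ (sym (ℤ.pos-* 1 (suc d))) (sym (ℤ.pos-* a 2)) le′))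

a/d≡1⇒a≡d : ∀ a d .{{_ : NonZero d}} → (+ a) ℚ./ d ≡ 1ℚ → a ≡ d
a/d≡1⇒a≡d a (suc d) eq
  with ℚᵘ.≃-trans (ℚᵘ.≃-sym (ℚ.toℚᵘ-fromℚᵘ (mkℚᵘ (+ a) d))) (ℚ.toℚᵘ-cong eq)
... | *≡* eq′ = begin
  a           ≡⟨ *-identityʳ a ⟨
  a * 1       ≡⟨ ℤ.+-injective (trans (ℤ.pos-* a 1) (trans eq′ (sym (ℤ.pos-* 1 (suc d))))) ⟩
  1 * suc d   ≡⟨ *-identityˡ (suc d) ⟩
  suc d       ∎
  where open ≡-Reasoning

answers? : (P : Program ℓ) (I : Instance ℓ) (t : ℕ) (b : Bool) → Decidable (λ (ω : Vec Bool t) → output P I ω ≡ just b)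
answers? P I t b ω = Maybe.≡-dec Bool._≟_ (output P I ω) (just b)

-- A filter that keeps as many elements as the list has keeps them all.
Pr≡1⇒always : (P : Program ℓ) (I : Instance ℓ) (t : ℕ) (b : Bool) → Pr P I t b ≡ 1ℚ →
  All (λ ω → output P I ω ≡ just b) (allCoins t)
Pr≡1⇒always P I t b eq = subst (All _)
  (filter-complete (answers? P I t b) (trans (a/d≡1⇒a≡d count (2 ^ t) {{m^n≢0 2 t}} eq) (sym (length-allCoins t))))
  (all-filter (answers? P I t b) (allCoins t))
  where
  count : ℕ
  count = length (filter (answers? P I t b) (allCoins t))

Pr≥½⇒half : (P : Program ℓ) (I : Instance ℓ) (t : ℕ) (b : Bool) → ½ ℚ.≤ Pr P I t b →
  2 ^ t ≤ 2 * length (filter (answers? P I t b) (allCoins t))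
Pr≥½⇒half P I t b = ½≤a/d⇒d≤2a (length (filter (answers? P I t b) (allCoins t))) (2 ^ t) {{m^n≢0 2 t}}

-- The pairs counted are a matching `x` and coins `ω` on which `yesInstance x` is accepted. Each `x`
-- occurs with at least half of the `2 ^ t` coin sequences, each `ω` with at most `t` matchings, and
-- `2 ^ t` cancels.
matchings≤2*time : (k m : ℕ) .{{_ : NonZero k}} (P : Program (suc (suc m))) → IsRandomizedAlgorithm P → (t : ℕ) →
  (∀ I → Instance.n I ≡ k ^ suc m → Instance.FirstHasRank I k → HaltsWithin P I t) → (k !) ^ m ≤ 2 * t
matchings≤2*time k m P alg t halts = *-cancelʳ-≤ ((k !) ^ m) (2 * t) (2 ^ t) {{m^n≢0 2 t}} (begin
  (k !) ^ m * 2 ^ t                  ≤⟨ n*a≤c*sum 2 (λ x → length (filter (accepts? x) (allCoins t))) half ⟩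
  2 * sum (λ x → length (filter (accepts? x) (allCoins t))) ≤⟨ *-monoʳ-≤ 2 (double-counting accepts? t (allCoins t)
                                          (All.map (λ {ω} → few ω) rejects)) ⟩
  2 * (length (allCoins t) * t)      ≡⟨ cong (λ l → 2 * (l * t)) (length-allCoins t) ⟩
  2 * (2 ^ t * t)                    ≡⟨ cong (2 *_) (*-comm (2 ^ t) t) ⟩
  2 * (t * 2 ^ t)                    ≡⟨ *-assoc 2 t (2 ^ t) ⟨
  2 * t * 2 ^ t                      ∎)
  where
  open ≤-Reasoning
  open Grid k m
  open IsRandomizedAlgorithm alg using () renaming (yes to correct-yes; no to correct-no)
  O₀ : Oracle (suc (suc m)) size
  O₀ i = Matroid.indep (Instance.matroid noInstance i)
  C₀ : Config
  C₀ = ⟨ 0 , (λ _ → 0) [ 0 ↦ size ] ⟩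
  accepts? : ∀ x → Decidable (λ (ω : Vec Bool t) → output P (yesInstance x) ω ≡ just true)
  accepts? x = answers? P (yesInstance x) t true
  rejects : All (λ ω → output P noInstance ω ≡ just false) (allCoins t)
  rejects = Pr≡1⇒always P noInstance t false
    (correct-no noInstance t (halts noInstance refl (gridInstance-rank transversal? id)) noInstance-no)
  half : ∀ x → 2 ^ t ≤ 2 * length (filter (accepts? x) (allCoins t))
  half x = Pr≥½⇒half P (yesInstance x) t true (correct-yes (yesInstance x) t
    (halts (yesInstance x) refl (gridInstance-rank (otherTransversal? x) proj₁)) (yesInstance-yes x))
  few : ∀ ω → output P noInstance ω ≡ just false → ∣ comprehension (λ x → accepts? x ω) ∣ ≤ t
  few ω rejected = begin
    -- Each accepted `x` is sent to a position of its matching in the list of queries; distinct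
    -- matchings occupy distinct positions.
    ∣ comprehension (λ x → accepts? x ω) ∣ ≤⟨ injective-relation⇒∣∣≤∣∣ _ ⊤ (λ x j → matching x ≡ lookup Q j)
      (λ x x∈ → let F∈Q = queried x (∈-comprehension⁻ (λ x → accepts? x ω) x∈) in index F∈Q , ∈⊤ , lookup-index F∈Q)
      (λ _ _ e e′ → matching-distinct (trans e (sym e′))) ⟩
    ∣ ⊤ {length Q} ∣                       ≡⟨ ∣⊤∣≡n (length Q) ⟩
    length Q                               ≤⟨ length-queries P O₀ ω C₀ ⟩
    t                                      ∎
    where
    Q : List (Subset size)
    Q = queries P O₀ ω C₀
    queried : ∀ x → output P (yesInstance x) ω ≡ just true → matching x List.∈ Q
    -- If the matching were never queried, the run on the yes-instance would copy the rejecting run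
    -- on the no-instance.
    queried x accepted = decidable-stable (any? (matching x ≟ˢ_) Q) λ F∉Q →
      just-false≢just-true (trans (sym rejected) (trans
        (run-cong P O₀ (λ i → Matroid.indep (Instance.matroid (yesInstance x) i)) ω C₀
          (λ i S S∈Q → instances-agree x i S (λ { refl → F∉Q S∈Q })))
        accepted))
      where
      just-false≢just-true : ∀ {A : Set} → just false ≡ just true → A
      just-false≢just-true ()

-- The running time

-- The value 0 is a default returned without testing `P 0`, hence a case of its own.
greatest-satisfies : {P : ℕ → Set} (P? : ∀ v → Dec (P v)) (b : ℕ) → greatest P? b ≡ 0 ⊎ P (greatest P? b)
greatest-satisfies P? zero    = inj₁ refl
greatest-satisfies P? (suc b) with P? (suc b)
... | yes p = inj₂ p
... | no  _ = greatest-satisfies P? b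

-- The first hypothesis is `z / q < m` cross-multiplied. By integrality the numerator falls short of
-- `m * q` by at least one, which pays for the factor `k ^ k` if `z ≥ 0`. If `z` is negative, the
-- factor moved to the left is already at least `k ^ k`, and the right side of the bound is 1.
clear-negative-exponent : ∀ z m q k v .{{_ : NonZero k}} → z ℤ.* + 1 ℤ.< + m ℤ.* + q →
  v ^ q * k ^ (neg z * k) ≤ k ^ (pos z * k) → v ^ q * k ^ k ≤ k ^ (m * q * k)
clear-negative-exponent (+ a) m q k v z<mq hyp = begin
  v ^ q * k ^ k              ≡⟨ cong (_* k ^ k) (*-identityʳ (v ^ q)) ⟨
  v ^ q * 1 * k ^ k          ≤⟨ *-monoˡ-≤ (k ^ k) hyp ⟩
  k ^ (a * k) * k ^ k        ≡⟨ *-comm (k ^ (a * k)) (k ^ k) ⟩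
  k ^ k * k ^ (a * k)        ≡⟨ ^-distribˡ-+-* k k (a * k) ⟨
  k ^ (suc a * k)            ≤⟨ ^-monoʳ-≤ k (*-monoˡ-≤ k a<mq) ⟩
  k ^ (m * q * k)            ∎
  where
  open ≤-Reasoning
  a<mq : a < m * q
  a<mq = ℤ.drop‿+<+ (subst₂ ℤ._<_ (ℤ.*-identityʳ (+ a)) (sym (ℤ.pos-* m q)) z<mq)
clear-negative-exponent -[1+ a ] m q k v z<mq hyp = begin
  v ^ q * k ^ k              ≤⟨ *-monoʳ-≤ (v ^ q) (^-monoʳ-≤ k (m≤m+n k (a * k))) ⟩
  v ^ q * k ^ (suc a * k)    ≤⟨ hyp ⟩
  1                          ≤⟨ m^n>0 k (m * q * k) ⟩
  k ^ (m * q * k)            ∎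
  where open ≤-Reasoning

runningTime-bound : ∀ x m k .{{_ : NonZero k}} → x ℚ.< + m ℚ./ 1 →
  ⌊2^[ x · k log]⌋ ^ ↧ₙ x * k ^ k ≤ k ^ (m * ↧ₙ x * k)
runningTime-bound x@(ℚ.mkℚ z d-1 _) m k x<m
  with greatest-satisfies {_≤2^[ x · k log]} (λ v → _ ≤? _) (k ^ (pos z * k))
-- The denominator is a successor, so `0 ^ ↧ₙ x` reduces to 0.
... | inj₁ v≡0  = subst (λ v → v ^ ↧ₙ x * k ^ k ≤ k ^ (m * ↧ₙ x * k)) (sym v≡0) z≤n
... | inj₂ v≤2^ with ℚᵘ.<-respʳ-≃ (ℚ.toℚᵘ-fromℚᵘ (mkℚᵘ (+ m) 0)) (ℚ.toℚᵘ-mono-< x<m)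
...   | *<* z<mq = clear-negative-exponent z m (↧ₙ x) k ⌊2^[ x · k log]⌋ z<mq v≤2^

2+m-2-ε<m : ∀ m ε → 0ℚ ℚ.< ε → (+ suc (suc m) ℚ./ 1) ℚ.- (+ 2 ℚ./ 1) ℚ.- ε ℚ.< + m ℚ./ 1
2+m-2-ε<m m ε 0<ε = begin-strict
  [2+m] ℚ.- [2] ℚ.- ε   ≡⟨ cong (λ x → x ℚ.- [2] ℚ.- ε) split ⟩
  [m] ℚ.+ [2] ℚ.- [2] ℚ.- ε ≡⟨ cong (ℚ._- ε) (ℚ.+-assoc [m] [2] (ℚ.- [2])) ⟩
  [m] ℚ.+ ([2] ℚ.- [2]) ℚ.- ε ≡⟨ cong (λ x → [m] ℚ.+ x ℚ.- ε) (ℚ.+-inverseʳ [2]) ⟩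
  [m] ℚ.+ 0ℚ ℚ.- ε      ≡⟨ cong (ℚ._- ε) (ℚ.+-identityʳ [m]) ⟩
  [m] ℚ.- ε             <⟨ ℚ.+-monoʳ-< [m] (ℚ.neg-antimono-< 0<ε) ⟩
  [m] ℚ.+ 0ℚ            ≡⟨ ℚ.+-identityʳ [m] ⟩
  [m]                   ∎
  where
  open ℚ.≤-Reasoning
  [2+m] [2] [m] : ℚ
  [2+m] = + suc (suc m) ℚ./ 1
  [2]   = + 2 ℚ./ 1
  [m]   = + m ℚ./ 1
  -- Normalised fractions do not compute for a variable `m`, so the identity is verified on
  -- unnormalised ones.
  split : [2+m] ≡ [m] ℚ.+ [2]
  split = ℚ.toℚᵘ-injective (ℚᵘ.≃-trans (ℚ.toℚᵘ-fromℚᵘ (mkℚᵘ (+ suc (suc m)) 0))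
    (ℚᵘ.≃-trans (*≡* (cong (ℤ._* + 1) (sum-in-ℤ)))
      (ℚᵘ.≃-trans (ℚᵘ.+-cong (ℚᵘ.≃-sym (ℚ.toℚᵘ-fromℚᵘ (mkℚᵘ (+ m) 0))) (ℚᵘ.≃-refl {ℚ.toℚᵘ [2]}))
        (ℚᵘ.≃-sym (ℚ.toℚᵘ-homo-+ [m] [2])))))
    where
    sum-in-ℤ : + suc (suc m) ≡ + m ℤ.* + 1 ℤ.+ + 2 ℤ.* + 1
    sum-in-ℤ = trans (cong +_ (+-comm 2 m)) (cong (ℤ._+ + 2) (sym (ℤ.*-identityʳ (+ m))))

-- On the grid the ground set has size `k ^ suc m`, so the time bound depends on `k` alone and a
-- single `t` serves all the hard instances. The count of matchings then contradicts the growth of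
-- `(k !) ^ m`.
no-algorithm-below : ∀ m x → x ℚ.< + m ℚ./ 1 →
  ¬ RandomizedParameterizedAlgorithm (suc (suc m)) (λ k → ⌊2^[ x · k log]⌋)
no-algorithm-below m x x<m record { program = P ; isRandomized = alg ; runsInTime = p , halts }
  with factorial-beats-time m (↧ₙ x) p
... | k , k≢0 , beats = <⇒≱ (beats ⌊2^[ x · k log]⌋ (runningTime-bound x m k {{k≢0}} x<m))
  (matchings≤2*time k m {{k≢0}} P alg (⌊2^[ x · k log]⌋ * eval p (k ^ suc m)) halts-in-time)
  where
  halts-in-time : ∀ I → Instance.n I ≡ k ^ suc m → Instance.FirstHasRank I k →
                  HaltsWithin P I (⌊2^[ x · k log]⌋ * eval p (k ^ suc m))
  halts-in-time I n≡ rank = subst (λ n → HaltsWithin P I (⌊2^[ x · k log]⌋ * eval p n)) n≡ (halts I k rank)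

theorem1p3 : (ℓ : ℕ) → ℓ ≥ 3 → (ε : ℚ) → 0ℚ ℚ.< ε →
    ¬ RandomizedParameterizedAlgorithm ℓ (λ k → ⌊2^[ (+ ℓ ℚ./ 1) ℚ.- (+ 2 ℚ./ 1) ℚ.- ε · k log]⌋)
theorem1p3 (suc (suc m)) (s≤s (s≤s _)) ε 0<ε =
  no-algorithm-below m ((+ suc (suc m) ℚ./ 1) ℚ.- (+ 2 ℚ./ 1) ℚ.- ε) (2+m-2-ε<m m ε 0<ε)
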